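{- Let $n\ge 1$. In every $2$-coloring of the edges of the ordered complete graph on $[n]$ there exists (i) a monochromatic non-crossing spanning tree; (ii) a monochromatic non-nested spanning tree; (iii) a monochromatic non-separated spanning tree.
   Context: The ordered complete graph on $[n]=\{1,\dots,n\}$ is the complete graph with vertex set $[n]$, taken with its natural ordering; edges are written $(i,j)$ with $i<j$. A $2$-coloring is an arbitrary assignment of one of two colors to each edge; a subgraph is monochromatic if all its edges have the same color. Two edges are independent if they share no vertex. Independent edges $(a,b)$ and $(c,d)$ are crossing if $a<c<b<d$ or $c<a<d<b$; nested if $a<c<d<b$ or $c<a<b<d$; separated if $a<b<c<d$ or $c<d<a<b$. A subgraph is non-crossing (resp. non-nested, non-separated) if it contains no two independent edges that are crossing (resp. nested, separated). A spanning tree is a subgraph that is a tree with vertex set $[n]$. -}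

module Defs where

open import Data.Bool using (Bool; T)
open import Data.Fin using (Fin; zero; suc; _<_; inject₁; fromℕ)
open import Data.Nat using (ℕ; _+_)
open import Data.Product using (_×_; Σ-syntax)
open import Data.Sum using (_⊎_)
open import Function.Definitions using (Injective)
open import Relation.Binary.Construct.Closure.ReflexiveTransitive using (Star)
open import Relation.Binary.PropositionalEquality using (_≡_; _≢_)
open import Relation.Nullary using (¬_)

-- The vertex set {1 < … < n} is represented by Fin n with its natural order.
-- The ordering proof is irrelevant, so an edge is determined definitionally
-- by its endpoints.
record Edge (n : ℕ) : Set where
  constructor edge
  field
    src tgt  : Fin n
    .src<tgt : src < tgt

open Edge public

Coloring : ℕ → Set
Coloring n = Edge n → Fin 2

-- Subgraphs with full vertex set Fin n, given by their (decidable) edge sets;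
-- only these can be spanning trees.
Subgraph : ℕ → Set
Subgraph n = Edge n → Bool

infix 4 _∈ᴱ_

_∈ᴱ_ : ∀ {n} → Edge n → Subgraph n → Set
e ∈ᴱ H = T (H e)

Independent Crossing Nested Separated : ∀ {n} → Edge n → Edge n → Set

Independent (edge a b _) (edge c d _) = a ≢ c × a ≢ d × b ≢ c × b ≢ d

Crossing (edge a b _) (edge c d _) =
  (a < c × c < b × b < d) ⊎ (c < a × a < d × d < b)

Nested (edge a b _) (edge c d _) =
  (a < c × c < d × d < b) ⊎ (c < a × a < b × b < d)

Separated (edge a b _) (edge c d _) =
  (a < b × b < c × c < d) ⊎ (c < d × d < a × a < b)

Avoids : ∀ {n} → (Edge n → Edge n → Set) → Subgraph n → Set
Avoids R H = ∀ e f → e ∈ᴱ H → f ∈ᴱ H → Independent e f → ¬ R e f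

NonCrossing NonNested NonSeparated : ∀ {n} → Subgraph n → Set
NonCrossing  = Avoids Crossing
NonNested    = Avoids Nested
NonSeparated = Avoids Separated

Monochromatic : ∀ {n} → Coloring n → Subgraph n → Set
Monochromatic χ H = ∀ e f → e ∈ᴱ H → f ∈ᴱ H → χ e ≡ χ f

Adjacent : ∀ {n} → Subgraph n → Fin n → Fin n → Set
Adjacent H u v =
  (Σ[ u<v ∈ u < v ] edge u v u<v ∈ᴱ H) ⊎ (Σ[ v<u ∈ v < u ] edge v u v<u ∈ᴱ H)

Connected : ∀ {n} → Subgraph n → Set
Connected H = ∀ u v → Star (Adjacent H) u v

-- A cycle is a cyclic sequence of k + 3 distinct vertices, consecutive ones
-- (including the last and the first) being adjacent.
record Cycle {n : ℕ} (H : Subgraph n) : Set where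
  field
    k         : ℕ
    vertex    : Fin (3 + k) → Fin n
    distinct  : Injective _≡_ _≡_ vertex
    step      : ∀ (i : Fin (2 + k)) →
                Adjacent H (vertex (inject₁ i)) (vertex (suc i))
    close     : Adjacent H (vertex (fromℕ (2 + k))) (vertex zero)

Acyclic : ∀ {n} → Subgraph n → Set
Acyclic H = ¬ Cycle H

-- The vertex set is all of Fin n, so for n ≥ 1 a tree here is a spanning tree.
IsSpanningTree : ∀ {n} → Subgraph n → Set
IsSpanningTree H = Connected H × Acyclic H

{-# OPTIONS --safe #-}

module Submission where

-- A connected spanning graph contains a spanning tree, and all the required properties pass
-- to subgraphs, so it suffices to find connected graphs.
--
-- Non-crossing: the edge (l, m) crosses nothing inside [l, m]; let c be its colour. By
-- induction every shorter interval has a graph of one of the two colours. If [l, k] and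
-- [k + 1, m] have colour c, add (l, m). Moving k down from m - 1, where [k + 1, m] is a point,
-- either this occurs, or [l, k] and [k, m] both have the other colour and are glued at k, or
-- [k, m] has colour c and the descent continues; at k = l the interval [l, k] is a point.
--
-- Non-nested: let c be the colour of (l, l + 1). If some [l, k] has colour c and [l, k + 1] the
-- other one, either colour of [k, m] can be glued to one of them. So assume that all [l, k] with
-- k < m have colour c. Build graphs of the other colour on [s, m] for s = m, m - 1, …, adding at
-- s the edge (s, w) with w as large as possible but at most every right endpoint in use. If no
-- such w exists, the edges (s, j) of colour c skipped at s and before extend the graph on [l, s]
-- to one on [l, m].
--
-- Non-separated: use edges (a, b) with a ≤ v ≤ b only, and increase v as long as each
-- colour has a hub beyond v, joined in that colour to all of [0, v]. If the opposite of c has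
-- no hub, every vertex beyond v is joined in colour c to [0, v], and [0, v] is connected
-- through a hub of colour c. If neither colour has one, take the colour of (0, v): a hub for
-- [0, v - 1] in this colour is left from the previous step, and v is joined to 0.

open import Data.Empty using (⊥)
open import Data.Fin as Fin using (Fin; zero; suc; inject₁; opposite; toℕ)
open import Data.Fin.Properties as Fin using (any?)
open import Data.Fin.Relation.Unary.Top using (view; ‵fromℕ; ‵inject₁)
open import Data.Nat using (ℕ; zero; suc; _+_; _≤_; _<_; z≤n; s≤s; s≤s⁻¹)
open import Data.Nat.DivMod using (_mod_; m<n⇒m%n≡m; m%n<n)
open import Data.Nat.Properties
open import Data.Product using (_×_; _,_; ∃-syntax; proj₁; proj₂)
open import Data.Sum as Sum using (_⊎_; inj₁; inj₂; swap; [_,_]′)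
open import Function using (_∘_; case_of_; id)
open import Level using (0ℓ)
open import Relation.Binary using (Rel)
open import Relation.Binary.Construct.Closure.Equivalence as Eq using (EqClosure)
open import Relation.Binary.Construct.Closure.ReflexiveTransitive as Star
  using (Star; ε; _◅_; _◅◅_)
open import Relation.Binary.Construct.Closure.Symmetric using (fwd; bwd)
open import Relation.Binary.PropositionalEquality
open import Relation.Nullary
open import Relation.Nullary.Decidable as Dec
  using (isYes; toWitness; fromWitness; _×-dec_; _⊎-dec_; ¬?; T?)
open import Relation.Unary using (Pred; Decidable; _∪_; _⊆_; ｛_｝)
open import Defs

-- Minimal witnesses and maximal values

least : ∀ {P : Pred ℕ 0ℓ} → Decidable P → ∀ k → P k → ∃[ m ] (P m × (∀ {j} → P j → m ≤ j))
least P? k pk with P? 0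
... | yes p0 = 0 , p0 , λ _ → z≤n
least P? zero pk | no ¬p0 = contradiction pk ¬p0
least {P} P? (suc k) pk | no ¬p0 =
  let m , pm , m≤ = least (P? ∘ suc) k pk
  in suc m , pm , λ { {zero} p0 → contradiction p0 ¬p0 ; {suc _} pj → s≤s (m≤ pj) }

argmax : ∀ {n} (f : Fin (suc n) → ℕ) → ∃[ i ] (∀ j → f j ≤ f i)
argmax {zero}  f = zero , λ { zero → ≤-refl }
argmax {suc n} f with argmax (f ∘ suc)
... | i , max with ≤-total (f zero) (f (suc i))
... | inj₁ f0≤ = suc i , λ { zero → f0≤ ; (suc j) → max j }
... | inj₂ ≤f0 = zero , λ { zero → ≤-refl ; (suc j) → ≤-trans (max j) ≤f0 }

-- Breadth-first spanning trees

module _ {n : ℕ} {H : Subgraph n} where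

  adjacent? : ∀ u v → Dec (Adjacent H u v)
  adjacent? u v = ordered u v ⊎-dec ordered v u
    where
    ordered : ∀ a b → Dec (∃[ a<b ] edge a b a<b ∈ᴱ H)
    ordered a b with a Fin.<? b
    ... | no  a≮b = no (a≮b ∘ proj₁)
    ... | yes a<b = Dec.map′ (a<b ,_) proj₂ (T? (H (edge a b a<b)))

  adjacent-edge : ∀ {e : Edge n} → Adjacent H (src e) (tgt e) → e ∈ᴱ H
  adjacent-edge {_} (inj₁ (_ , e∈H)) = e∈H
  adjacent-edge {edge a b a<b} (inj₂ (b<a , _)) =
    contradiction b<a (Fin.<-asym (recompute (a Fin.<? b) a<b))

  cycle-neighbours : (C : Cycle H) → let open Cycle C in ∀ i →
    ∃[ j ] ∃[ j′ ] (j ≢ j′ × Adjacent H (vertex i) (vertex j) × Adjacent H (vertex i) (vertex j′))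
  cycle-neighbours C zero =
    suc zero , _ , (λ ()) , step zero , swap close
    where open Cycle C
  cycle-neighbours C (suc i) with view i
  ... | ‵fromℕ = inject₁ i , zero , (λ ()) , swap (step i) , close
    where open Cycle C
  ... | ‵inject₁ j = inject₁ i , suc (suc j) , distinct-neighbours , swap (step i) , step (suc j)
    where
    open Cycle C
    distinct-neighbours : inject₁ (inject₁ j) ≢ suc (suc j)
    distinct-neighbours eq = m≢1+n+m (toℕ j) (begin
      toℕ j                       ≡⟨ trans (Fin.toℕ-inject₁ (inject₁ j)) (Fin.toℕ-inject₁ j) ⟨
      toℕ (inject₁ (inject₁ j))   ≡⟨ cong toℕ eq ⟩
      2 + toℕ j                   ∎)
      where open ≡-Reasoning

module _ {n : ℕ} {H : Subgraph (suc n)} (connected : Connected H) where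

  private
    -- Grading by length makes walks decidable, so that `least` yields the distance from the root
    -- `zero`.
    Walk : ℕ → Fin (suc n) → Set
    Walk zero    v = v ≡ zero
    Walk (suc k) v = ∃[ u ] (Adjacent H u v × Walk k u)

    walk? : ∀ k → Decidable (Walk k)
    walk? zero    v = v Fin.≟ zero
    walk? (suc k) v = any? λ u → adjacent? {H = H} u v ×-dec walk? k u

    walk : ∀ {v} → Star (Adjacent H) v zero → ∃[ k ] Walk k v
    walk ε       = 0 , refl
    walk (a ◅ s) = let k , w = walk s in suc k , _ , swap a , w

    shortest : ∀ v → ∃[ k ] (Walk k v × (∀ {j} → Walk j v → k ≤ j))
    shortest v = let k , w = walk (connected v zero) in least (λ k → walk? k v) k w

    depth : Fin (suc n) → ℕ
    depth = proj₁ ∘ shortest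

    -- The last edge of a shortest walk comes from a vertex nearer the root. The value at the root
    -- itself is a dummy.
    predecessor : ∀ v → ∃[ u ] (v ≢ zero → Adjacent H u v × depth u < depth v)
    predecessor v with shortest v
    ... | zero  , v≡0 , _ = zero , contradiction v≡0
    ... | suc k , (u , a , w) , _ = u , λ _ → a , s≤s (proj₂ (proj₂ (shortest u)) w)

    Parent : Fin (suc n) → Fin (suc n) → Set
    Parent u v = v ≢ zero × proj₁ (predecessor v) ≡ u

    parent? : ∀ u v → Dec (Parent u v)
    parent? u v = ¬? (v Fin.≟ zero) ×-dec (proj₁ (predecessor v) Fin.≟ u)

    parent-adjacent : ∀ {u v} → Parent u v → Adjacent H u v
    parent-adjacent (v≢0 , refl) = proj₁ (proj₂ (predecessor _) v≢0)

    parent-depth : ∀ {u v} → Parent u v → depth u < depth v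
    parent-depth (v≢0 , refl) = proj₂ (proj₂ (predecessor _) v≢0)

    edge? : ∀ u v → Dec (Parent u v ⊎ Parent v u)
    edge? u v = parent? u v ⊎-dec parent? v u

    tree : Subgraph (suc n)
    tree (edge u v _) = isYes (edge? u v)

    tree⇒parent : ∀ {u v} → Adjacent tree u v → Parent u v ⊎ Parent v u
    tree⇒parent {u} {v} (inj₁ (_ , t)) = toWitness {a? = edge? u v} t
    tree⇒parent {u} {v} (inj₂ (_ , t)) = swap (toWitness {a? = edge? v u} t)

    parent⇒tree : ∀ {u v} → Parent u v → Adjacent tree u v
    parent⇒tree {u} {v} p with parent-adjacent p
    ... | inj₁ (u<v , _) = inj₁ (u<v , fromWitness {a? = edge? u v} (inj₁ p))
    ... | inj₂ (v<u , _) = inj₂ (v<u , fromWitness {a? = edge? v u} (inj₂ p))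

    to-root : ∀ d v → depth v < d → Star (Adjacent tree) v zero
    to-root (suc d) v depth<1+d = case v Fin.≟ zero of λ
      { (yes refl) → ε
      ; (no  v≢0)  →
          swap (parent⇒tree (v≢0 , refl)) ◅
          to-root d _ (<-≤-trans (parent-depth (v≢0 , refl)) (s≤s⁻¹ depth<1+d)) }

    acyclic : Acyclic tree
    acyclic C =
      let i , deepest            = argmax (depth ∘ vertex)
          j , j′ , j≢j′ , a , a′ = cycle-neighbours C i
      in j≢j′ (distinct (trans (sym (parent-of i deepest j a)) (parent-of i deepest j′ a′)))
      where
      open Cycle C
      parent-of : ∀ i → (∀ j → depth (vertex j) ≤ depth (vertex i)) →
                  ∀ j → Adjacent tree (vertex i) (vertex j) →
                  proj₁ (predecessor (vertex i)) ≡ vertex j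
      parent-of i deepest j a with tree⇒parent a
      ... | inj₁ p       = contradiction (parent-depth p) (≤⇒≯ (deepest j))
      ... | inj₂ (_ , q) = q

  -- The breadth-first search tree: every vertex other than the root hangs off a
  -- neighbour of smaller depth, so a deepest vertex of a cycle would have two parents.
  spanning-tree : ∃[ t ] (IsSpanningTree t × (∀ e → e ∈ᴱ t → e ∈ᴱ H))
  spanning-tree = tree , (tree-connected , acyclic) , λ e → tree⊆H e
    where
    tree-connected : Connected tree
    tree-connected u v =
      to-root _ u ≤-refl ◅◅
      Star.reverse (swap) (to-root _ v ≤-refl)
    tree⊆H : ∀ e → e ∈ᴱ tree → e ∈ᴱ H
    tree⊆H e@(edge u v _) t = adjacent-edge {H = H} {e} (case toWitness {a? = edge? u v} t of λ
      { (inj₁ p) → parent-adjacent p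
      ; (inj₂ p) → swap (parent-adjacent p) })

-- Graphs on sets of naturals

Conflict : Set₁
Conflict = ℕ → ℕ → ℕ → ℕ → Set

Interval : ℕ → ℕ → Pred ℕ 0ℓ
Interval l m v = l ≤ v × v ≤ m

module _ (col : ℕ → ℕ → Fin 2) where

  -- `R` is one orientation of a conflict; `avoids` covers both by ranging over ordered pairs.
  record Graph (R : Conflict) (V : Pred ℕ 0ℓ) (c : Fin 2) : Set₁ where
    field
      E         : Rel ℕ 0ℓ
      E?        : ∀ a b → Dec (E a b)
      ordered   : ∀ {a b} → E a b → a < b
      within    : ∀ {a b} → E a b → V a × V b
      coloured  : ∀ {a b} → E a b → col a b ≡ c
      avoids    : ∀ {a b a′ b′} → E a b → E a′ b′ → ¬ R a b a′ b′
      connected : ∀ {u v} → V u → V v → EqClosure E u v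

  open Graph public

module _ {col : ℕ → ℕ → Fin 2} {R : Conflict} {c : Fin 2} where

  resize : ∀ {V W} → V ⊆ W → W ⊆ V → Graph col R V c → Graph col R W c
  resize V⊆W W⊆V G = record
    { E         = G .E
    ; E?        = G .E?
    ; ordered   = G .ordered
    ; within    = λ e → let Va , Vb = G .within e in V⊆W Va , V⊆W Vb
    ; coloured  = G .coloured
    ; avoids    = G .avoids
    ; connected = λ Wu Wv → G .connected (W⊆V Wu) (W⊆V Wv)
    }

  point : ∀ a → Graph col R (Interval a a) c
  point a = record
    { E         = λ _ _ → ⊥
    ; E?        = λ _ _ → no id
    ; ordered   = λ ()
    ; within    = λ ()
    ; coloured  = λ ()
    ; avoids    = λ ()
    ; connected = λ { (a≤u , u≤a) (a≤v , v≤a) →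
        subst (EqClosure _ _) (trans (≤-antisym u≤a a≤u) (≤-antisym a≤v v≤a)) ε }
    }

  -- `avoids` also compares an edge with itself, hence the irreflexivity hypothesis.
  single : ∀ {a b} → (∀ {a b} → ¬ R a b a b) → a < b → col a b ≡ c →
           Graph col R (｛ a ｝ ∪ ｛ b ｝) c
  single {a} {b} irrefl a<b col≡c = record
    { E         = Edge-ab
    ; E?        = λ x y → (a ≟ x) ×-dec (b ≟ y)
    ; ordered   = λ { (refl , refl) → a<b }
    ; within    = λ { (refl , refl) → inj₁ refl , inj₂ refl }
    ; coloured  = λ { (refl , refl) → col≡c }
    ; avoids    = λ { (refl , refl) (refl , refl) → irrefl }
    ; connected = λ Vu Vv → Eq.symmetric _ (from-a Vu) ◅◅ from-a Vv
    }
    where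
    Edge-ab : Rel ℕ 0ℓ
    Edge-ab x y = a ≡ x × b ≡ y
    from-a : ∀ {v} → (｛ a ｝ ∪ ｛ b ｝) v → EqClosure Edge-ab a v
    from-a (inj₁ refl) = ε
    from-a (inj₂ refl) = fwd (refl , refl) ◅ ε

  Compatible : ∀ {V W} → Graph col R V c → Graph col R W c → Set
  Compatible G G′ = ∀ {a b a′ b′} → G .E a b → G′ .E a′ b′ → ¬ R a b a′ b′ × ¬ R a′ b′ a b

  join : ∀ {V W x} (G : Graph col R V c) (G′ : Graph col R W c) →
         Compatible G G′ → V x → W x → Graph col R (V ∪ W) c
  join {V} {W} {x} G G′ compatible Vx Wx = record
    { E         = E∪
    ; E?        = λ a b → G .E? a b ⊎-dec G′ .E? a b
    ; ordered   = [ G .ordered , G′ .ordered ]′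
    ; within    = λ { (inj₁ e) → let Va , Vb = G .within e in inj₁ Va , inj₁ Vb
                    ; (inj₂ e) → let Wa , Wb = G′ .within e in inj₂ Wa , inj₂ Wb }
    ; coloured  = [ G .coloured , G′ .coloured ]′
    ; avoids    = λ { (inj₁ e) (inj₁ f) → G .avoids e f
                    ; (inj₁ e) (inj₂ f) → proj₁ (compatible e f)
                    ; (inj₂ e) (inj₁ f) → proj₂ (compatible f e)
                    ; (inj₂ e) (inj₂ f) → G′ .avoids e f }
    ; connected = λ Vu Vv → Eq.symmetric _ (from-x Vu) ◅◅ from-x Vv
    }
    where
    E∪ : Rel ℕ 0ℓ
    E∪ a b = G .E a b ⊎ G′ .E a b
    from-x : ∀ {v} → (V ∪ W) v → EqClosure E∪ x v
    from-x (inj₁ Vv) = Eq.map inj₁ (G .connected Vx Vv)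
    from-x (inj₂ Wv) = Eq.map inj₂ (G′ .connected Wx Wv)

two-colours : ∀ (c d : Fin 2) → d ≡ c ⊎ d ≡ opposite c
two-colours zero       zero       = inj₁ refl
two-colours zero       (suc zero) = inj₂ refl
two-colours (suc zero) zero       = inj₂ refl
two-colours (suc zero) (suc zero) = inj₁ refl

-- Transfer between naturals and `Fin`

module _ {N : ℕ} (χ : Coloring (suc N)) where

  private
    clamp : ℕ → Fin (suc N)
    clamp a = a mod suc N

    toℕ-clamp : ∀ {a} → a ≤ N → toℕ (clamp a) ≡ a
    toℕ-clamp {a} a≤N = trans (Fin.toℕ-fromℕ< (m%n<n a (suc N))) (m<n⇒m%n≡m (s≤s a≤N))

    clamp-toℕ : ∀ i → clamp (toℕ i) ≡ i
    clamp-toℕ i = Fin.toℕ-injective (toℕ-clamp (Fin.toℕ≤pred[n] i))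

    pair-colour : Fin (suc N) → Fin (suc N) → Fin 2
    pair-colour a b with a Fin.<? b
    ... | yes a<b = χ (edge a b a<b)
    ... | no  _   = zero

    pair-colour-edge : ∀ e → pair-colour (src e) (tgt e) ≡ χ e
    pair-colour-edge (edge a b a<b) with a Fin.<? b
    ... | yes _  = refl
    ... | no a≮b = contradiction (recompute (a Fin.<? b) a<b) a≮b

  -- Arguments outside [0, N] are read modulo N + 1, and non-increasing pairs get colour 0.
  colouring : ℕ → ℕ → Fin 2
  colouring a b = pair-colour (clamp a) (clamp b)

  colouring-edge : ∀ e → colouring (toℕ (src e)) (toℕ (tgt e)) ≡ χ e
  colouring-edge e =
    trans (cong₂ pair-colour (clamp-toℕ (src e)) (clamp-toℕ (tgt e))) (pair-colour-edge e)

  spanning-graph⇒tree :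
    ∀ {R : Conflict} {Q : Edge (suc N) → Edge (suc N) → Set} →
    (∀ e f → Q e f →
      R (toℕ (src e)) (toℕ (tgt e)) (toℕ (src f)) (toℕ (tgt f)) ⊎
      R (toℕ (src f)) (toℕ (tgt f)) (toℕ (src e)) (toℕ (tgt e))) →
    ∃[ c ] Graph colouring R (Interval 0 N) c →
    ∃[ H ] (IsSpanningTree H × Monochromatic χ H × Avoids Q H)
  spanning-graph⇒tree {R} Q⇒R (c , G) =
    let t , isTree , t⊆H = spanning-tree {H = H} H-connected in
    t , isTree ,
    (λ e f e∈t f∈t → trans (H-colour e (t⊆H e e∈t)) (sym (H-colour f (t⊆H f f∈t)))) ,
    (λ e f e∈t f∈t _ q →
      [ G .avoids (H-edge e (t⊆H e e∈t)) (H-edge f (t⊆H f f∈t))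
      , G .avoids (H-edge f (t⊆H f f∈t)) (H-edge e (t⊆H e e∈t)) ]′ (Q⇒R e f q))
    where
    H : Subgraph (suc N)
    H e = isYes (G .E? (toℕ (src e)) (toℕ (tgt e)))

    H-edge : ∀ e → e ∈ᴱ H → G .E (toℕ (src e)) (toℕ (tgt e))
    H-edge e = toWitness {a? = G .E? (toℕ (src e)) (toℕ (tgt e))}

    H-colour : ∀ e → e ∈ᴱ H → χ e ≡ c
    H-colour e e∈H = trans (sym (colouring-edge e)) (G .coloured (H-edge e e∈H))

    H-adjacent : ∀ {a b} → G .E a b → Adjacent H (clamp a) (clamp b)
    H-adjacent {a} {b} e =
      let (_ , a≤N) , (_ , b≤N) = G .within e
          eqa = sym (toℕ-clamp a≤N)
          eqb = sym (toℕ-clamp b≤N)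
      in inj₁ ( subst₂ _<_ eqa eqb (G .ordered e)
              , fromWitness {a? = G .E? (toℕ (clamp a)) (toℕ (clamp b))} (subst₂ (G .E) eqa eqb e))

    H-connected : Connected H
    H-connected u v =
      subst₂ (Star (Adjacent H)) (clamp-toℕ u) (clamp-toℕ v)
        (Star.gmap clamp (λ { (fwd e) → H-adjacent e ; (bwd e) → swap (H-adjacent e) })
          (G .connected (z≤n , Fin.toℕ≤pred[n] u) (z≤n , Fin.toℕ≤pred[n] v)))

-- Non-crossing trees

-- Induction on the length m - l, offering proper prefixes and suffixes only; in `go`, `d` bounds
-- this length.
interval-rec :
  (P : ℕ → ℕ → Set₁) →
  (∀ {l m} → l ≤ m →
    (∀ {k} → l ≤ k → k < m → P l k) →
    (∀ {k} → l < k → k ≤ m → P k m) →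
    P l m) →
  ∀ {l m} → l ≤ m → P l m
interval-rec P step l≤m = go _ l≤m (m≤n+m _ _)
  where
  go : ∀ d {l m} → l ≤ m → m ≤ l + d → P l m
  go zero {l} l≤m m≤l+0 =
    step l≤m
      (λ l≤k k<m → contradiction (<-≤-trans (≤-<-trans l≤k k<m) m≤l) (<-irrefl refl))
      (λ l<k k≤m → contradiction (<-≤-trans (<-≤-trans l<k k≤m) m≤l) (<-irrefl refl))
    where
    m≤l = ≤-trans m≤l+0 (≤-reflexive (+-identityʳ l))
  go (suc d) {l} l≤m m≤l+1+d =
    step l≤m
      (λ l≤k k<m → go d l≤k (s≤s⁻¹ (≤-trans k<m m≤1+l+d)))
      (λ l<k k≤m → go d k≤m (≤-trans m≤1+l+d (+-monoˡ-≤ d l<k)))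
    where
    m≤1+l+d = ≤-trans m≤l+1+d (≤-reflexive (+-suc l d))

-- The bound `k ≤ suc j` admits both overlapping and merely adjacent intervals.
split-∪ : ∀ {l j k m} → l ≤ k → k ≤ suc j → j ≤ m → Interval l m ⊆ Interval l j ∪ Interval k m
split-∪ {j = j} l≤k k≤1+j j≤m {v} (l≤v , v≤m) with v ≤? j
... | yes v≤j = inj₁ (l≤v , v≤j)
... | no  v≰j = inj₂ (≤-trans k≤1+j (≰⇒> v≰j) , v≤m)

∪-split : ∀ {l j k m} → l ≤ k → j ≤ m → Interval l j ∪ Interval k m ⊆ Interval l m
∪-split l≤k j≤m (inj₁ (l≤v , v≤j)) = l≤v , ≤-trans v≤j j≤m
∪-split l≤k j≤m (inj₂ (k≤v , v≤m)) = ≤-trans l≤k k≤v , v≤m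

module _ (col : ℕ → ℕ → Fin 2) where

  Cross : Conflict
  Cross a b a′ b′ = a < a′ × a′ < b × b < b′

  module _ {c : Fin 2} where

    -- Left edges end by k and right edges start from k on, so neither kind starts strictly inside
    -- the other.
    cross-glue : ∀ {l k m} → l ≤ k → k ≤ m →
                 Graph col Cross (Interval l k) c → Graph col Cross (Interval k m) c →
                 Graph col Cross (Interval l m) c
    cross-glue l≤k k≤m G G′ =
      resize (∪-split l≤k k≤m) (split-∪ l≤k (n≤1+n _) k≤m)
        (join G G′ compatible (l≤k , ≤-refl) (≤-refl , k≤m))
      where
      compatible : Compatible G G′
      compatible e f with G .within e | G′ .within f
      ... | (_ , a≤k) , (_ , b≤k) | (k≤a′ , _) , _ =
        (λ (_ , a′<b , _) → <⇒≱ a′<b (≤-trans b≤k k≤a′)) ,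
        (λ (a′<a , _) → <⇒≱ a′<a (≤-trans a≤k k≤a′))

    -- The edge (l, m) links two disjoint pieces; crossing it would take an endpoint outside [l, m].
    cross-bridge : ∀ {l k m} → l ≤ k → k < m → col l m ≡ c →
                   Graph col Cross (Interval l k) c → Graph col Cross (Interval (suc k) m) c →
                   Graph col Cross (Interval l m) c
    cross-bridge {l} {k} {m} l≤k k<m col≡c G G′ =
      resize
        (λ { (inj₁ (inj₁ (inj₁ refl))) → ≤-refl , l≤m
           ; (inj₁ (inj₁ (inj₂ refl))) → l≤m , ≤-refl
           ; (inj₁ (inj₂ v∈))          → ∪-split l≤1+k k≤m (inj₁ v∈)
           ; (inj₂ v∈)                 → ∪-split l≤1+k k≤m (inj₂ v∈) })
        (Sum.map₁ inj₂ ∘ split-∪ l≤1+k ≤-refl k≤m)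
        (join (join lm G lm-compatible (inj₁ refl) (≤-refl , l≤k)) G′ compatible
          (inj₁ (inj₂ refl)) (k<m , ≤-refl))
      where
      l≤1+k = m≤n⇒m≤1+n l≤k
      k≤m   = <⇒≤ k<m
      l≤m   = ≤-trans l≤k k≤m
      lm : Graph col Cross (｛ l ｝ ∪ ｛ m ｝) c
      lm = single (λ (a<a , _) → <-irrefl refl a<a) (≤-<-trans l≤k k<m) col≡c
      lm-compatible : Compatible lm G
      lm-compatible (refl , refl) f with G .within f
      ... | (l≤a′ , _) , (_ , b′≤k) =
        (λ (_ , _ , m<b′) → <⇒≱ m<b′ (≤-trans b′≤k k≤m)) ,
        (λ (a′<l , _) → <⇒≱ a′<l l≤a′)
      compatible : Compatible (join lm G lm-compatible (inj₁ refl) (≤-refl , l≤k)) G′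
      compatible (inj₁ (refl , refl)) f with G′ .within f
      ... | (k<a′ , _) , (_ , b′≤m) =
        (λ (_ , _ , m<b′) → <⇒≱ m<b′ b′≤m) ,
        (λ (a′<l , _) → <⇒≱ a′<l (≤-trans l≤1+k k<a′))
      compatible (inj₂ e) f with G .within e | G′ .within f
      ... | (_ , a≤k) , (_ , b≤k) | (k<a′ , _) , _ =
        (λ (_ , a′<b , _) → <⇒≱ a′<b (≤-trans b≤k (<⇒≤ k<a′))) ,
        (λ (a′<a , _) → <⇒≱ a′<a (≤-trans a≤k (<⇒≤ k<a′)))

  noncrossing : ∀ {l m} → l ≤ m → ∃[ c ] Graph col Cross (Interval l m) c
  noncrossing = interval-rec (λ l m → ∃[ c ] Graph col Cross (Interval l m) c) step
    where
    step : ∀ {l m} → l ≤ m →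
           (∀ {k} → l ≤ k → k < m → ∃[ c ] Graph col Cross (Interval l k) c) →
           (∀ {k} → l < k → k ≤ m → ∃[ c ] Graph col Cross (Interval k m) c) →
           ∃[ c ] Graph col Cross (Interval l m) c
    step {l} {m} l≤m prefix suffix with m≤n⇒m<n∨m≡n l≤m
    ... | inj₂ refl        = zero , point l
    ... | inj₁ (s≤s l≤m-1) = descend _ l≤m-1 ≤-refl (point m)
      where
      c = col l m
      descend : ∀ k → l ≤ k → k < m → Graph col Cross (Interval (suc k) m) c →
                ∃[ c ] Graph col Cross (Interval l m) c
      descend k l≤k k<m G′ with m≤n⇒m<n∨m≡n l≤k
      ... | inj₂ refl = c , cross-bridge l≤k k<m refl (point l) G′
      ... | inj₁ l<k@(s≤s l≤k-1) with prefix l≤k k<m | suffix l<k (<⇒≤ k<m)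
      ... | d , G | d′ , G″ with two-colours c d | two-colours c d′
      ... | inj₁ refl | _         = c , cross-bridge l≤k k<m refl G G′
      ... | inj₂ refl | inj₂ refl = opposite c , cross-glue l≤k (<⇒≤ k<m) G G″
      ... | inj₂ _    | inj₁ refl = descend _ l≤k-1 (<⇒≤ k<m) G″

-- Non-nested trees

split-∪-point : ∀ {l m} → l ≤ suc m → Interval l (suc m) ⊆ Interval l m ∪ ｛ suc m ｝
split-∪-point l≤1+m (l≤v , v≤1+m) with m≤n⇒m<n∨m≡n v≤1+m
... | inj₁ (s≤s v≤m) = inj₁ (l≤v , v≤m)
... | inj₂ refl      = inj₂ refl

module _ (col : ℕ → ℕ → Fin 2) where

  Nest : Conflict
  Nest a b a′ b′ = a < a′ × b′ < b

  nest-irrefl : ∀ {a b} → ¬ Nest a b a b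
  nest-irrefl (a<a , _) = <-irrefl refl a<a

  module _ {c : Fin 2} where

    -- An edge a < b is read as the cell in row a and column b of a triangular matrix.
    RowsUpTo : ∀ {V} → ℕ → Graph col Nest V c → Set
    RowsUpTo s G = ∀ {a b} → G .E a b → a ≤ s

    ColumnsFrom : ∀ {V} → ℕ → Graph col Nest V c → Set
    ColumnsFrom y G = ∀ {a b} → G .E a b → y ≤ b

    -- The two intervals may even share the two vertices k and k + 1.
    nest-glue : ∀ {l j k m} → l ≤ k → k ≤ j → j ≤ suc k → j ≤ m →
                Graph col Nest (Interval l j) c → Graph col Nest (Interval k m) c →
                Graph col Nest (Interval l m) c
    nest-glue {j = j} {k} l≤k k≤j j≤1+k j≤m G G′ =
      resize (∪-split l≤k j≤m) (split-∪ l≤k (m≤n⇒m≤1+n k≤j) j≤m)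
        (join G G′ compatible (l≤k , k≤j) (≤-refl , ≤-trans k≤j j≤m))
      where
      compatible : Compatible G G′
      compatible e f with G .within e | G .ordered e | G′ .within f | G′ .ordered f
      ... | _ , (_ , b≤j) | a<b | (k≤a′ , _) , _ | a′<b′ =
        -- Left edges start by k and end by k + 1; right edges start from k on and end from k + 1
        -- on.
        (λ (_ , b′<b) → <⇒≱ b′<b (≤-trans b≤j (≤-trans j≤1+k (≤-<-trans k≤a′ a′<b′)))) ,
        (λ (a′<a , _) → <⇒≱ a′<a (≤-trans (s≤s⁻¹ (≤-trans a<b (≤-trans b≤j j≤1+k))) k≤a′))

    -- Each added edge (s, j) starts no earlier and ends later than all edges already present, so it
    -- nests with none.
    extend-right : ∀ {l s w} y → l ≤ s → s ≤ w → w ≤ y →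
                   (∀ {j} → w < j → j ≤ y → col s j ≡ c) →
                   (G : Graph col Nest (Interval l w) c) → RowsUpTo s G →
                   ∃[ G′ ] RowsUpTo {Interval l y} s G′
    extend-right {l} {s} {w} y l≤s s≤w w≤y row G rows with m≤n⇒m<n∨m≡n w≤y
    ... | inj₂ refl = G , rows
    ... | inj₁ (s≤s {n = y-1} w≤y-1)
      with extend-right y-1 l≤s s≤w w≤y-1 (λ w<j j≤y-1 → row w<j (m≤n⇒m≤1+n j≤y-1)) G rows
    ... | G₁ , rows₁ =
      resize
        (λ { (inj₁ (l≤v , v≤y-1))   → l≤v , m≤n⇒m≤1+n v≤y-1
           ; (inj₂ (inj₁ refl)) → l≤s , <⇒≤ s<y
           ; (inj₂ (inj₂ refl)) → ≤-trans l≤s (<⇒≤ s<y) , ≤-refl })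
        (Sum.map₂ inj₂ ∘ split-∪-point (≤-trans l≤s (<⇒≤ s<y)))
        (join G₁ sy compatible (l≤s , s≤s⁻¹ s<y) (inj₁ refl)) ,
      λ { (inj₁ e) → rows₁ e ; (inj₂ (refl , refl)) → ≤-refl }
      where
      s<y = s≤s (≤-trans s≤w w≤y-1)
      sy : Graph col Nest (｛ s ｝ ∪ ｛ suc y-1 ｝) c
      sy = single nest-irrefl s<y (row (s≤s w≤y-1) ≤-refl)
      compatible : Compatible G₁ sy
      compatible e (refl , refl) =
        (λ (_ , y<b) → <⇒≱ y<b (m≤n⇒m≤1+n (proj₂ (proj₂ (G₁ .within e))))) ,
        (λ (s<a , _) → <⇒≱ s<a (rows₁ e))

    -- The edge (s, w) starts before all edges of `G` and, as w ≤ y, ends no later than any of them.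
    extend-left : ∀ {s m y w} → s < w → w ≤ y → y ≤ m → col s w ≡ c →
                  (G : Graph col Nest (Interval (suc s) m) c) → ColumnsFrom y G →
                  ∃[ G′ ] ColumnsFrom {Interval s m} w G′
    extend-left {s} {m} {y} {w} s<w w≤y y≤m col≡c G columns =
      resize
        (λ { (inj₁ (s<v , v≤m)) → <⇒≤ s<v , v≤m
           ; (inj₂ (inj₁ refl)) → ≤-refl , ≤-trans (<⇒≤ s<w) w≤m
           ; (inj₂ (inj₂ refl)) → <⇒≤ s<w , w≤m })
        (λ { (s≤v , v≤m) → case m≤n⇒m<n∨m≡n s≤v of λ
           { (inj₁ s<v)  → inj₁ (s<v , v≤m)
           ; (inj₂ refl) → inj₂ (inj₁ refl) } })
        (join G sw compatible (s<w , w≤m) (inj₂ refl)) ,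
      λ { (inj₁ e) → ≤-trans w≤y (columns e) ; (inj₂ (refl , refl)) → ≤-refl }
      where
      w≤m = ≤-trans w≤y y≤m
      sw : Graph col Nest (｛ s ｝ ∪ ｛ w ｝) c
      sw = single nest-irrefl s<w col≡c
      compatible : Compatible G sw
      compatible e (refl , refl) =
        (λ (a<s , _) → <⇒≱ a<s (<⇒≤ (proj₁ (proj₁ (G .within e))))) ,
        (λ (_ , b<w) → <⇒≱ b<w (≤-trans w≤y (columns e)))

  -- The greedy choice of the sweep. The cells of colour c to the right of w are kept for the graph
  -- of colour c that is needed if the sweep gets stuck.
  last-in-row : ∀ c s y →
    (∃[ w ] (s < w × w ≤ y × col s w ≡ opposite c × (∀ {j} → w < j → j ≤ y → col s j ≡ c))) ⊎
    (∀ {j} → s < j → j ≤ y → col s j ≡ c)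
  last-in-row c s zero = inj₂ λ s<j j≤0 → contradiction (<-≤-trans s<j j≤0) λ ()
  last-in-row c s (suc y) with s <? suc y
  ... | no s≮1+y = inj₂ λ s<j j≤1+y → contradiction (<-≤-trans s<j j≤1+y) s≮1+y
  ... | yes s<1+y with two-colours c (col s (suc y))
  ... | inj₂ eq = inj₁ (suc y , s<1+y , ≤-refl , eq , λ y<j j≤y → contradiction j≤y (<⇒≱ y<j))
  ... | inj₁ eq = Sum.map
    (λ (w , s<w , w≤y , eq′ , rest) → w , s<w , m≤n⇒m≤1+n w≤y , eq′ , include rest)
    include
    (last-in-row c s y)
    where
    include : ∀ {i} → (∀ {j} → i < j → j ≤ y → col s j ≡ c) →
              ∀ {j} → i < j → j ≤ suc y → col s j ≡ c
    include rest i<j j≤1+y with m≤n⇒m<n∨m≡n j≤1+y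
    ... | inj₁ (s≤s j≤y) = rest i<j j≤y
    ... | inj₂ refl      = eq

  NonNestedGraph : ℕ → ℕ → Set₁
  NonNestedGraph l m = ∃[ c ] Graph col Nest (Interval l m) c

  -- Sweeps s downwards, the last argument being an invariant: any graph of colour c on
  -- [l, y] with rows up to s would already lead to a solution.
  nest-sweep : ∀ {l m c} →
    (∀ {k} → l ≤ k → k < m → NonNestedGraph l m ⊎ Graph col Nest (Interval l k) c) →
    ∀ {y} s → l ≤ s → s < y → y ≤ m →
    (G : Graph col Nest (Interval (suc s) m) (opposite c)) → ColumnsFrom y G →
    ((B : Graph col Nest (Interval l y) c) → RowsUpTo s B → NonNestedGraph l m) →
    NonNestedGraph l m
  nest-sweep {c = c} prefix {y} s l≤s s<y y≤m G columns finish with last-in-row c s y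
  ... | inj₂ row with prefix l≤s (<-≤-trans s<y y≤m)
  ... | inj₁ solution = solution
  ... | inj₂ B =
    let B′ , rows = extend-right y l≤s ≤-refl (<⇒≤ s<y) row B (λ e → proj₂ (proj₁ (B .within e)))
    in finish B′ rows
  nest-sweep prefix {y} s l≤s s<y y≤m G columns finish
    | inj₁ (w , s<w , w≤y , eq , row)
    with extend-left s<w w≤y y≤m eq G columns | m≤n⇒m<n∨m≡n l≤s
  ... | G′ , _        | inj₂ refl        = _ , G′
  ... | G′ , columns′ | inj₁ (s≤s l≤s-1) =
    -- The bound y drops to w. A graph of colour c on [l, w] grows along the skipped cells of row s
    -- to [l, y], where the old `finish` applies.
    nest-sweep prefix _ l≤s-1 (<⇒≤ s<w) (≤-trans w≤y y≤m) G′ columns′ λ B rows →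
      let B′ , rows′ = extend-right y l≤s (<⇒≤ s<w) w≤y row B (m≤n⇒m≤1+n ∘ rows)
      in finish B′ rows′

  nonnested : ∀ {l m} → l ≤ m → NonNestedGraph l m
  nonnested = interval-rec NonNestedGraph step
    where
    step : ∀ {l m} → l ≤ m →
           (∀ {k} → l ≤ k → k < m → NonNestedGraph l k) →
           (∀ {k} → l < k → k ≤ m → NonNestedGraph k m) →
           NonNestedGraph l m
    step {l} {m} l≤m prefix suffix with m≤n⇒m<n∨m≡n l≤m
    ... | inj₂ refl        = zero , point l
    ... | inj₁ (s≤s l≤m-1) =
      -- The sweep starts at s = m - 1 and y = m, where a graph of colour c on [l, y] is itself a
      -- solution.
      nest-sweep (λ {k} → prefixes k) _ l≤m-1 ≤-refl ≤-refl (point m)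
        (λ ()) (λ B _ → c , B)
      where
      c = col l (suc l)
      prefixes : ∀ k → l ≤ k → k < m → NonNestedGraph l m ⊎ Graph col Nest (Interval l k) c
      prefixes k l≤k k<m with m≤n⇒m<n∨m≡n l≤k
      ... | inj₂ refl = inj₂ (point l)
      prefixes (suc k) _ k+1<m | inj₁ (s≤s l≤k) with m≤n⇒m<n∨m≡n l≤k
      -- The argument below needs l < k for [k, m] to be a proper suffix; here the choice of c
      -- settles [l, l + 1].
      ... | inj₂ refl = inj₂ (proj₁ (extend-right (suc l) ≤-refl ≤-refl (n≤1+n l)
        (λ l<j j≤1+l → cong (col l) (≤-antisym j≤1+l l<j)) (point l) λ ()))
      ... | inj₁ l<k
        with prefixes k l≤k (<⇒≤ k+1<m)
           | prefix (m≤n⇒m≤1+n l≤k) k+1<m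
           | suffix l<k (<⇒≤ (<⇒≤ k+1<m))
      ... | inj₁ solution | _ | _ = inj₁ solution
      ... | inj₂ G | d , G′ | d′ , G″ with two-colours c d | two-colours c d′
      ... | inj₁ refl | _         = inj₂ G′
      -- The colour changes between [l, k] and [l, k + 1]. If [k, m] has colour c it shares k with
      -- the former, otherwise k and k + 1 with the latter.
      ... | inj₂ refl | inj₁ refl = inj₁ (_ , nest-glue l≤k ≤-refl (n≤1+n k) (<⇒≤ (<⇒≤ k+1<m)) G G″)
      ... | inj₂ refl | inj₂ refl = inj₁ (_ , nest-glue l≤k (n≤1+n k) ≤-refl (<⇒≤ k+1<m) G′ G″)

-- Non-separated trees

module _ (col : ℕ → ℕ → Fin 2) (N : ℕ) where

  Separate : Conflict
  Separate a b a′ b′ = b < a′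

  Over : ℕ → Fin 2 → Rel ℕ 0ℓ
  Over v c a b = a < b × a ≤ v × v ≤ b × b ≤ N × col a b ≡ c

  -- Any two edges over v satisfy a′ ≤ v ≤ b, so they are not separated. `core` connects [0, v] and
  -- `attach` hangs the later vertices on it.
  over-graph : ∀ {v c r} → (∀ {u} → u ≤ v → EqClosure (Over v c) r u) →
               (∀ {x} → v < x → x ≤ N → ∃[ a ] (a ≤ v × col a x ≡ c)) →
               Graph col Separate (Interval 0 N) c
  over-graph {v} {c} {r} core attach = record
    { E         = Over v c
    ; E?        = λ a b → (a <? b) ×-dec (a ≤? v) ×-dec (v ≤? b) ×-dec (b ≤? N) ×-dec
                          (col a b Fin.≟ c)
    ; ordered   = proj₁
    ; within    = λ (a<b , _ , _ , b≤N , _) → (z≤n , ≤-trans (<⇒≤ a<b) b≤N) , (z≤n , b≤N)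
    ; coloured  = λ (_ , _ , _ , _ , eq) → eq
    ; avoids    = λ (_ , _ , v≤b , _) (_ , a′≤v , _) → ≤⇒≯ (≤-trans a′≤v v≤b)
    ; connected = λ (_ , u≤N) (_ , w≤N) → Eq.symmetric _ (from-r u≤N) ◅◅ from-r w≤N
    }
    where
    from-r : ∀ {u} → u ≤ N → EqClosure (Over v c) r u
    from-r {u} u≤N with u ≤? v
    ... | yes u≤v = core u≤v
    ... | no  u≰v =
      let v<u = ≰⇒> u≰v
          a , a≤v , eq = attach v<u u≤N
      in core a≤v ◅◅ fwd (≤-<-trans a≤v v<u , a≤v , <⇒≤ v<u , u≤N , eq) ◅ ε

  -- Off by one: a hub beyond v for [0, v] is `Hub (suc v)`. `Hub 0` is trivial and starts the
  -- search.
  Hub : ℕ → Fin 2 → Set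
  Hub v c = ∃[ h ] (h < suc N × v ≤ h × (∀ {a} → a < v → col a h ≡ c))

  hub? : ∀ v c → Dec (Hub v c)
  hub? v c = anyUpTo? (λ h → (v ≤? h) ×-dec allUpTo? (λ a → col a h Fin.≟ c) v) (suc N)

  -- A vertex x with no edge of colour c to [0, v] would itself be a hub of the opposite colour.
  no-hub⇒attached : ∀ {v c} → ¬ Hub (suc v) (opposite c) →
                    ∀ {x} → v < x → x ≤ N → ∃[ a ] (a ≤ v × col a x ≡ c)
  no-hub⇒attached {v} {c} ¬hub {x} v<x x≤N with anyUpTo? (λ a → col a x Fin.≟ c) (suc v)
  ... | yes (a , s≤s a≤v , eq) = a , a≤v , eq
  ... | no none = contradiction
    (x , s≤s x≤N , v<x , λ {a} a≤v →
      [ (λ eq → contradiction (a , a≤v , eq) none) , id ]′ (two-colours c (col a x)))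
    ¬hub

  no-hubs : ∀ {v} → ¬ Hub v zero → ¬ Hub v (suc zero) → ∀ c → ¬ Hub v c
  no-hubs ¬hub₀ _ zero       = ¬hub₀
  no-hubs _ ¬hub₁ (suc zero) = ¬hub₁

  core-via-hub : ∀ {v c} ((h , _) : Hub (suc v) c) → ∀ {u} → u ≤ v → EqClosure (Over v c) h u
  core-via-hub (h , s≤s h≤N , v<h , col≡c) u≤v =
    bwd (≤-<-trans u≤v v<h , u≤v , <⇒≤ v<h , h≤N , col≡c (s≤s u≤v)) ◅ ε

  -- The path v, 0, h, u uses only edges over v. For v = 0, where `col 0 0` is not the colour of an
  -- edge, only `ε` occurs.
  core-via-zero : ∀ {v} → v ≤ N → Hub v (col 0 v) →
                  ∀ {u} → u ≤ v → EqClosure (Over v (col 0 v)) v u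
  core-via-zero v≤N (h , s≤s h≤N , v≤h , col≡c) u≤v with m≤n⇒m<n∨m≡n u≤v
  ... | inj₂ refl = ε
  ... | inj₁ u<v  =
    bwd (0<v , z≤n , ≤-refl , v≤N , refl) ◅
    fwd (<-≤-trans 0<v v≤h , z≤n , v≤h , h≤N , col≡c 0<v) ◅
    bwd (<-≤-trans u<v v≤h , u≤v , v≤h , h≤N , col≡c u<v) ◅ ε
    where 0<v = ≤-<-trans z≤n u<v

  nonseparated-from : ∀ d {v} → v ≤ N → N < v + d → (∀ c → Hub v c) →
                      ∃[ c ] Graph col Separate (Interval 0 N) c
  nonseparated-from zero {v} v≤N N<v+0 _ =
    contradiction (<-≤-trans N<v+0 (≤-reflexive (+-identityʳ v))) (≤⇒≯ v≤N)
  nonseparated-from (suc d) {v} v≤N N<v+1+d hubs with hub? (suc v) zero | hub? (suc v) (suc zero)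
  ... | yes hub₀ | no ¬hub₁ = _ , over-graph (core-via-hub hub₀) (no-hub⇒attached ¬hub₁)
  ... | no ¬hub₀ | yes hub₁ = _ , over-graph (core-via-hub hub₁) (no-hub⇒attached ¬hub₀)
  -- At v = N no hub lies beyond v, so the search ends here at the latest.
  ... | no ¬hub₀ | no ¬hub₁ =
    _ , over-graph (core-via-zero v≤N (hubs (col 0 v))) (no-hub⇒attached (no-hubs ¬hub₀ ¬hub₁ _))
  ... | yes hub₀@(_ , s≤s h≤N , v<h , _) | yes hub₁ =
    nonseparated-from d (≤-trans v<h h≤N) (<-≤-trans N<v+1+d (≤-reflexive (+-suc v d)))
      λ { zero → hub₀ ; (suc zero) → hub₁ }

  nonseparated : ∃[ c ] Graph col Separate (Interval 0 N) c
  nonseparated = nonseparated-from (suc N) z≤n ≤-refl λ _ → 0 , s≤s z≤n , z≤n , λ ()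

theorem2p1 : ∀ (n : ℕ) → 1 ≤ n → (χ : Coloring n) →
    (∃[ H ] (IsSpanningTree H × Monochromatic χ H × NonCrossing H)) ×
    (∃[ H ] (IsSpanningTree H × Monochromatic χ H × NonNested H)) ×
    (∃[ H ] (IsSpanningTree H × Monochromatic χ H × NonSeparated H))
theorem2p1 (suc N) _ χ =
  spanning-graph⇒tree χ (λ _ _ → id) (noncrossing col z≤n) ,
  spanning-graph⇒tree χ
    (λ _ _ → Sum.map (λ (a<c , _ , d<b) → a<c , d<b) (λ (c<a , _ , b<d) → c<a , b<d))
    (nonnested col z≤n) ,
  spanning-graph⇒tree χ
    (λ _ _ → Sum.map (λ (_ , b<c , _) → b<c) (λ (_ , d<a , _) → d<a))
    (nonseparated col N)
  where col = colouring χ
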